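{- Let $S,T$ be as in the context. If $\mathrm{Pr}_T(x)$ is a $\Sigma_1$ provability predicate of $T$ satisfying $\mathbf{CB}$, then $T\nvdash\mathrm{RFN}_T(\Delta_0)$.
   Context: $\mathcal{L}_A=\{0,\mathsf{s},+,\times,\leq\}$ is the language of first-order arithmetic, and "formula" means $\mathcal{L}_A$-formula; $\ulcorner\varphi\urcorner$ is the numeral of the Gödel number of $\varphi$. $S$ and $T$ are consistent c.e. extensions of Peano Arithmetic $\mathsf{PA}$ in the language $\mathcal{L}_A$ such that $T$ is stronger than $S$ (every theorem of $S$ is a theorem of $T$; $S=T$ is allowed). A formula $\mathrm{Pr}_T(x)$ is a provability predicate of $T$ if for every formula $\varphi$: $T\vdash\varphi$ if and only if $S\vdash\mathrm{Pr}_T(\ulcorner\varphi\urcorner)$. A $\Sigma_1$ provability predicate is one that is a $\Sigma_1$ formula. $\ulcorner\varphi(\vec{\dot{x}})\urcorner$ is a term with free variables $\vec{x}$ for the primitive recursive function that computes from $\vec{n}$ the Gödel number of $\varphi(\overline{\vec{n}})$, the result of substituting the numerals of $\vec{n}$ for $\vec{x}$ in $\varphi(\vec{x})$. $\mathbf{CB}$: $S\vdash\mathrm{Pr}_T(\ulcorner\forall\vec{x}\,\varphi(\vec{x})\urcorner)\to\forall\vec{x}\,\mathrm{Pr}_T(\ulcorner\varphi(\vec{\dot{x}})\urcorner)$ for every formula $\varphi(\vec{x})$. $\mathrm{RFN}_T(\Delta_0)$ is the set $\{\forall\vec{x}\,(\mathrm{Pr}_T(\ulcorner\varphi(\vec{\dot{x}})\urcorner)\to\varphi(\vec{x}))\mid\varphi(\vec{x})\text{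 is a }\Delta_0\text{ formula}\}$; $T\nvdash\mathrm{RFN}_T(\Delta_0)$ means that $T$ fails to prove at least one member of this set. -}

module Defs where

open import Data.Nat using (ℕ; zero; suc; _+_; _*_; _<_; pred)
open import Data.Nat.Properties using (<-cmp; <⇒≢; +-monoʳ-≤; *-mono-≤; m≤m+n; +-cancelˡ-≡; module ≤-Reasoning)
open import Data.Nat.Tactic.RingSolver using (solve-∀)
open import Data.Fin using (Fin; zero; suc; toℕ; splitAt)
open import Data.Fin.Properties using (toℕ-injective)
open import Data.List using (List; []; _∷_; map)
open import Data.List.Membership.Propositional using (_∈_)
open import Data.Product using (_×_; _,_; proj₁; proj₂; ∃-syntax)
open import Data.Sum using (_⊎_; inj₁; inj₂)
open import Data.Vec using (Vec; []; _∷_; lookup)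
open import Function.Bundles using (_⇔_)
open import Level using (0ℓ)
open import Relation.Binary using (tri<; tri≈; tri>)
open import Relation.Binary.PropositionalEquality using (_≡_; refl; sym; trans; cong; cong₂)
open import Relation.Nullary using (¬_; contradiction)
open import Relation.Unary using (Pred)

------------------------------------------------------------------------
-- Syntax of first-order arithmetic

-- Well-scoped de Bruijn syntax: `Formula n` is the type of formulas whose
-- free variables are among x₀, …, xₙ₋₁.

infixl 8 _⊗_
infixl 7 _⊕_
infix  6 _≐_ _≼_
infixr 5 _∧_
infixr 4 _∨_
infixr 3 _⇒_ _⇔̇_
infix  6 ∼_

data Term (n : ℕ) : Set where
  var : Fin n → Term n
  𝟎   : Term n
  𝐬   : Term n → Term n
  _⊕_ : Term n → Term n → Term n
  _⊗_ : Term n → Term n → Term n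

data Formula (n : ℕ) : Set where
  ⊥̇   : Formula n
  _≐_ : Term n → Term n → Formula n
  _≼_ : Term n → Term n → Formula n
  _⇒_ : Formula n → Formula n → Formula n
  _∧_ : Formula n → Formula n → Formula n
  _∨_ : Formula n → Formula n → Formula n
  ∀̇   : Formula (suc n) → Formula n
  ∃̇   : Formula (suc n) → Formula n

Sentence : Set
Sentence = Formula 0

∼_ : ∀ {n} → Formula n → Formula n
∼ φ = φ ⇒ ⊥̇

_⇔̇_ : ∀ {n} → Formula n → Formula n → Formula n
φ ⇔̇ ψ = (φ ⇒ ψ) ∧ (ψ ⇒ φ)

∀̇* : ∀ {n} → Formula n → Sentence
∀̇* {zero}  φ = φ
∀̇* {suc n} φ = ∀̇* (∀̇ φ)

numeral : ∀ {n} → ℕ → Term n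
numeral zero    = 𝟎
numeral (suc k) = 𝐬 (numeral k)

------------------------------------------------------------------------
-- Renaming and substitution

Ren : ℕ → ℕ → Set
Ren m n = Fin m → Fin n

liftʳ : ∀ {m n} → Ren m n → Ren (suc m) (suc n)
liftʳ ρ zero    = zero
liftʳ ρ (suc x) = suc (ρ x)

renᵗ : ∀ {m n} → Ren m n → Term m → Term n
renᵗ ρ (var x) = var (ρ x)
renᵗ ρ 𝟎       = 𝟎
renᵗ ρ (𝐬 t)   = 𝐬 (renᵗ ρ t)
renᵗ ρ (t ⊕ u) = renᵗ ρ t ⊕ renᵗ ρ u
renᵗ ρ (t ⊗ u) = renᵗ ρ t ⊗ renᵗ ρ u

ren : ∀ {m n} → Ren m n → Formula m → Formula n
ren ρ ⊥̇       = ⊥̇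
ren ρ (t ≐ u) = renᵗ ρ t ≐ renᵗ ρ u
ren ρ (t ≼ u) = renᵗ ρ t ≼ renᵗ ρ u
ren ρ (φ ⇒ ψ) = ren ρ φ ⇒ ren ρ ψ
ren ρ (φ ∧ ψ) = ren ρ φ ∧ ren ρ ψ
ren ρ (φ ∨ ψ) = ren ρ φ ∨ ren ρ ψ
ren ρ (∀̇ φ)   = ∀̇ (ren (liftʳ ρ) φ)
ren ρ (∃̇ φ)   = ∃̇ (ren (liftʳ ρ) φ)

wkᵗ : ∀ {n} → Term n → Term (suc n)
wkᵗ = renᵗ suc

wk : ∀ {n} → Formula n → Formula (suc n)
wk = ren suc

embed : ∀ {n} → Sentence → Formula n
embed = ren λ ()

Sub : ℕ → ℕ → Set
Sub m n = Fin m → Term n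

liftˢ : ∀ {m n} → Sub m n → Sub (suc m) (suc n)
liftˢ σ zero    = var zero
liftˢ σ (suc x) = wkᵗ (σ x)

subᵗ : ∀ {m n} → Sub m n → Term m → Term n
subᵗ σ (var x) = σ x
subᵗ σ 𝟎       = 𝟎
subᵗ σ (𝐬 t)   = 𝐬 (subᵗ σ t)
subᵗ σ (t ⊕ u) = subᵗ σ t ⊕ subᵗ σ u
subᵗ σ (t ⊗ u) = subᵗ σ t ⊗ subᵗ σ u

sub : ∀ {m n} → Sub m n → Formula m → Formula n
sub σ ⊥̇       = ⊥̇
sub σ (t ≐ u) = subᵗ σ t ≐ subᵗ σ u
sub σ (t ≼ u) = subᵗ σ t ≼ subᵗ σ u
sub σ (φ ⇒ ψ) = sub σ φ ⇒ sub σ ψ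
sub σ (φ ∧ ψ) = sub σ φ ∧ sub σ ψ
sub σ (φ ∨ ψ) = sub σ φ ∨ sub σ ψ
sub σ (∀̇ φ)   = ∀̇ (sub (liftˢ σ) φ)
sub σ (∃̇ φ)   = ∃̇ (sub (liftˢ σ) φ)

instantiate : ∀ {n} → Term n → Sub (suc n) n
instantiate t zero    = t
instantiate t (suc x) = var x

infix 9 _[_] _⟨_⟩

_[_] : ∀ {n} → Formula (suc n) → Term n → Formula n
φ [ t ] = sub (instantiate t) φ

-- For a formula P(x) in one free variable, P ⟨ t ⟩ is P(t), where t may
-- have free variables of its own.
_⟨_⟩ : ∀ {n} → Formula 1 → Term n → Formula n
P ⟨ t ⟩ = sub (λ _ → t) P

------------------------------------------------------------------------
-- Theories and provability: classical natural deduction with equality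

Theory : Set₁
Theory = Pred Sentence 0ℓ

infix 2 _∣_⊢_ _⊢_ _⊬_

data _∣_⊢_ (T : Theory) : ∀ {n} → List (Formula n) → Formula n → Set where
  ax    : ∀ {n} {Γ : List (Formula n)} {σ} → T σ → T ∣ Γ ⊢ embed σ
  hyp   : ∀ {n} {Γ : List (Formula n)} {φ} → φ ∈ Γ → T ∣ Γ ⊢ φ
  raa   : ∀ {n} {Γ : List (Formula n)} {φ} → T ∣ ∼ φ ∷ Γ ⊢ ⊥̇ → T ∣ Γ ⊢ φ
  ⇒I    : ∀ {n} {Γ : List (Formula n)} {φ ψ} → T ∣ φ ∷ Γ ⊢ ψ → T ∣ Γ ⊢ φ ⇒ ψ
  ⇒E    : ∀ {n} {Γ : List (Formula n)} {φ ψ} → T ∣ Γ ⊢ φ ⇒ ψ → T ∣ Γ ⊢ φ → T ∣ Γ ⊢ ψ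
  ∧I    : ∀ {n} {Γ : List (Formula n)} {φ ψ} → T ∣ Γ ⊢ φ → T ∣ Γ ⊢ ψ → T ∣ Γ ⊢ φ ∧ ψ
  ∧E₁   : ∀ {n} {Γ : List (Formula n)} {φ ψ} → T ∣ Γ ⊢ φ ∧ ψ → T ∣ Γ ⊢ φ
  ∧E₂   : ∀ {n} {Γ : List (Formula n)} {φ ψ} → T ∣ Γ ⊢ φ ∧ ψ → T ∣ Γ ⊢ ψ
  ∨I₁   : ∀ {n} {Γ : List (Formula n)} {φ ψ} → T ∣ Γ ⊢ φ → T ∣ Γ ⊢ φ ∨ ψ
  ∨I₂   : ∀ {n} {Γ : List (Formula n)} {φ ψ} → T ∣ Γ ⊢ ψ → T ∣ Γ ⊢ φ ∨ ψ
  ∨E    : ∀ {n} {Γ : List (Formula n)} {φ ψ χ} → T ∣ Γ ⊢ φ ∨ ψ → T ∣ φ ∷ Γ ⊢ χ → T ∣ ψ ∷ Γ ⊢ χ → T ∣ Γ ⊢ χ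
  ∀I    : ∀ {n} {Γ : List (Formula n)} {φ} → T ∣ map wk Γ ⊢ φ → T ∣ Γ ⊢ ∀̇ φ
  ∀E    : ∀ {n} {Γ : List (Formula n)} {φ} t → T ∣ Γ ⊢ ∀̇ φ → T ∣ Γ ⊢ φ [ t ]
  ∃I    : ∀ {n} {Γ : List (Formula n)} {φ} t → T ∣ Γ ⊢ φ [ t ] → T ∣ Γ ⊢ ∃̇ φ
  ∃E    : ∀ {n} {Γ : List (Formula n)} {φ ψ} → T ∣ Γ ⊢ ∃̇ φ → T ∣ φ ∷ map wk Γ ⊢ wk ψ → T ∣ Γ ⊢ ψ
  ≐refl : ∀ {n} {Γ : List (Formula n)} t → T ∣ Γ ⊢ t ≐ t
  ≐subst : ∀ {n} {Γ : List (Formula n)} (φ : Formula (suc n)) {t u} → T ∣ Γ ⊢ t ≐ u → T ∣ Γ ⊢ φ [ t ] → T ∣ Γ ⊢ φ [ u ]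

_⊢_ : ∀ {n} → Theory → Formula n → Set
T ⊢ φ = T ∣ [] ⊢ φ

_⊬_ : ∀ {n} → Theory → Formula n → Set
T ⊬ φ = ¬ (T ⊢ φ)

-- A set of sentences is unprovable when some member of it is.
_⊬ˢ_ : Theory → Pred Sentence 0ℓ → Set
T ⊬ˢ Φ = ∃[ σ ] Φ σ × (T ⊬ σ)

Consistent : Theory → Set
Consistent T = T ⊬ ⊥̇ {0}

_IsExtendedBy_ : Theory → Theory → Set
S IsExtendedBy T = ∀ {n} (φ : Formula n) → S ⊢ φ → T ⊢ φ

------------------------------------------------------------------------
-- Peano Arithmetic

private
  x₀ : ∀ {n} → Term (suc n)
  x₀ = var zero

  x₁ : ∀ {n} → Term (suc (suc n))
  x₁ = var (suc zero)

  x₂ : ∀ {n} → Term (suc (suc (suc n)))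
  x₂ = var (suc (suc zero))

-- φ(s(x₀)), with the other variables unchanged
atSuc : ∀ {n} → Formula (suc n) → Formula (suc n)
atSuc {n} = sub σ
  where
  σ : Sub (suc n) (suc n)
  σ zero    = 𝐬 x₀
  σ (suc x) = var (suc x)

data PA : Theory where
  s≢0 : PA (∀̇ (∼ (𝐬 x₀ ≐ 𝟎)))
  s-inj : PA (∀̇ (∀̇ (𝐬 x₁ ≐ 𝐬 x₀ ⇒ x₁ ≐ x₀)))
  +-0 : PA (∀̇ (x₀ ⊕ 𝟎 ≐ x₀))
  +-s : PA (∀̇ (∀̇ (x₁ ⊕ 𝐬 x₀ ≐ 𝐬 (x₁ ⊕ x₀))))
  ×-0 : PA (∀̇ (x₀ ⊗ 𝟎 ≐ 𝟎))
  ×-s : PA (∀̇ (∀̇ (x₁ ⊗ 𝐬 x₀ ≐ x₁ ⊗ x₀ ⊕ x₁)))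
  ≤-def : PA (∀̇ (∀̇ ((x₁ ≼ x₀) ⇔̇ ∃̇ (x₀ ⊕ x₂ ≐ x₁))))
  induction : ∀ {n} (φ : Formula (suc n)) → PA (∀̇* (φ [ 𝟎 ] ⇒ ∀̇ (φ ⇒ atSuc φ) ⇒ ∀̇ φ))

------------------------------------------------------------------------
-- Δ₀ and Σ₁ formulas

data Δ₀ : ∀ {n} → Formula n → Set where
  ⊥̇   : ∀ {n} → Δ₀ {n} ⊥̇
  _≐_ : ∀ {n} (t u : Term n) → Δ₀ (t ≐ u)
  _≼_ : ∀ {n} (t u : Term n) → Δ₀ (t ≼ u)
  _⇒_ : ∀ {n} {φ ψ : Formula n} → Δ₀ φ → Δ₀ ψ → Δ₀ (φ ⇒ ψ)
  _∧_ : ∀ {n} {φ ψ : Formula n} → Δ₀ φ → Δ₀ ψ → Δ₀ (φ ∧ ψ)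
  _∨_ : ∀ {n} {φ ψ : Formula n} → Δ₀ φ → Δ₀ ψ → Δ₀ (φ ∨ ψ)
  ∀≼  : ∀ {n} (t : Term n) {φ : Formula (suc n)} → Δ₀ φ → Δ₀ (∀̇ (x₀ ≼ wkᵗ t ⇒ φ))
  ∃≼  : ∀ {n} (t : Term n) {φ : Formula (suc n)} → Δ₀ φ → Δ₀ (∃̇ (x₀ ≼ wkᵗ t ∧ φ))

data Σ₁ : ∀ {n} → Formula n → Set where
  δ : ∀ {n} {φ : Formula n} → Δ₀ φ → Σ₁ φ
  ∃̇ : ∀ {n} {φ : Formula (suc n)} → Σ₁ φ → Σ₁ (∃̇ φ)

------------------------------------------------------------------------
-- Gödel numbering

-- The pairing (a , b) ↦ (a + b)² + a is injective and a polynomial, hence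
-- the value of a term of the language.
pair : ℕ → ℕ → ℕ
pair a b = (a + b) * (a + b) + a

-- A term is uniquely sᵏ(h) where h is not a successor. It is coded by k
-- together with a code of h, so that the number of the k-th numeral is
-- pair k 0, a polynomial in k.
leadingSuccs : ∀ {n} → Term n → ℕ
leadingSuccs (𝐬 t) = suc (leadingSuccs t)
leadingSuccs _     = 0

headTag : ∀ {n} → Term n → ℕ
headTag 𝟎       = 0
headTag (var _) = 1
headTag (_ ⊕ _) = 2
headTag (_ ⊗ _) = 3
headTag (𝐬 t)   = headTag t

mutual
  gnᵗ : ∀ {n} → Term n → ℕ
  gnᵗ t = pair (leadingSuccs t) (head t)

  head : ∀ {n} → Term n → ℕ
  head t = pair (headTag t) (headBody t)

  headBody : ∀ {n} → Term n → ℕ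
  headBody 𝟎       = 0
  headBody (var x) = toℕ x
  headBody (t ⊕ u) = pair (gnᵗ t) (gnᵗ u)
  headBody (t ⊗ u) = pair (gnᵗ t) (gnᵗ u)
  headBody (𝐬 t)   = headBody t

tag : ∀ {n} → Formula n → ℕ
tag ⊥̇       = 0
tag (_ ≐ _) = 1
tag (_ ≼ _) = 2
tag (_ ⇒ _) = 3
tag (_ ∧ _) = 4
tag (_ ∨ _) = 5
tag (∀̇ _)   = 6
tag (∃̇ _)   = 7

mutual
  gn : ∀ {n} → Formula n → ℕ
  gn φ = pair (tag φ) (body φ)

  body : ∀ {n} → Formula n → ℕ
  body ⊥̇       = 0
  body (t ≐ u) = pair (gnᵗ t) (gnᵗ u)
  body (t ≼ u) = pair (gnᵗ t) (gnᵗ u)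
  body (φ ⇒ ψ) = pair (gn φ) (gn ψ)
  body (φ ∧ ψ) = pair (gn φ) (gn ψ)
  body (φ ∨ ψ) = pair (gn φ) (gn ψ)
  body (∀̇ φ)   = gn φ
  body (∃̇ φ)   = gn φ

⌜_⌝ : ∀ {m n} → Formula m → Term n
⌜ φ ⌝ = numeral (gn φ)

------------------------------------------------------------------------
-- The terms ⌜φ(ẋ)⌝

-- For φ with b bound variables x₀, …, x_{b-1} in scope, followed by n free
-- ones, these terms mirror the clauses of gn, except that a free variable
-- is treated as the numeral of its value. Thus ⌜φ(ẋ)⌝ is literally a term
-- of the language; `dot-correct` below says that its value is right.

pairᵗ : ∀ {n} → Term n → Term n → Term n
pairᵗ t u = (t ⊕ u) ⊗ (t ⊕ u) ⊕ t

dotVarSuccs : ∀ {b n} → Fin b ⊎ Fin n → Term n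
dotVarSuccs (inj₁ _) = 𝟎
dotVarSuccs (inj₂ i) = var i

dotVarHead : ∀ {b n} → Fin b ⊎ Fin n → Term n
dotVarHead (inj₁ j) = pairᵗ (numeral 1) (numeral (toℕ j))
dotVarHead (inj₂ i) = pairᵗ (numeral 0) (numeral 0)

dotSuccs : ∀ b {n} → Term (b + n) → Term n
dotSuccs b (var x) = dotVarSuccs (splitAt b x)
dotSuccs b (𝐬 t)   = 𝐬 (dotSuccs b t)
dotSuccs b _       = 𝟎

mutual
  dotᵗ : ∀ b {n} → Term (b + n) → Term n
  dotᵗ b t = pairᵗ (dotSuccs b t) (dotHead b t)

  dotHead : ∀ b {n} → Term (b + n) → Term n
  dotHead b 𝟎       = pairᵗ (numeral 0) (numeral 0)
  dotHead b (var x) = dotVarHead (splitAt b x)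
  dotHead b (t ⊕ u) = pairᵗ (numeral 2) (pairᵗ (dotᵗ b t) (dotᵗ b u))
  dotHead b (t ⊗ u) = pairᵗ (numeral 3) (pairᵗ (dotᵗ b t) (dotᵗ b u))
  dotHead b (𝐬 t)   = dotHead b t

mutual
  dotᶠ : ∀ b {n} → Formula (b + n) → Term n
  dotᶠ b φ = pairᵗ (numeral (tag φ)) (dotBody b φ)

  dotBody : ∀ b {n} → Formula (b + n) → Term n
  dotBody b ⊥̇       = 𝟎
  dotBody b (t ≐ u) = pairᵗ (dotᵗ b t) (dotᵗ b u)
  dotBody b (t ≼ u) = pairᵗ (dotᵗ b t) (dotᵗ b u)
  dotBody b (φ ⇒ ψ) = pairᵗ (dotᶠ b φ) (dotᶠ b ψ)
  dotBody b (φ ∧ ψ) = pairᵗ (dotᶠ b φ) (dotᶠ b ψ)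
  dotBody b (φ ∨ ψ) = pairᵗ (dotᶠ b φ) (dotᶠ b ψ)
  dotBody b (∀̇ φ)   = dotᶠ (suc b) φ
  dotBody b (∃̇ φ)   = dotᶠ (suc b) φ

⌜_⌝˙ : ∀ {n} → Formula n → Term n
⌜ φ ⌝˙ = dotᶠ 0 φ

------------------------------------------------------------------------
-- Computably enumerable theories

-- Codes of partial recursive functions, with their graphs.

data Rec : ℕ → Set where
  zeroʳ : ∀ {n} → Rec n
  sucʳ  : Rec 1
  projʳ : ∀ {n} → Fin n → Rec n
  compʳ : ∀ {m n} → Rec m → Vec (Rec n) m → Rec n
  primʳ : ∀ {n} → Rec n → Rec (suc (suc n)) → Rec (suc n)
  minʳ  : ∀ {n} → Rec (suc n) → Rec n

infix 4 _⟪_⟫↦_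

data _⟪_⟫↦_ : ∀ {n} → Rec n → Vec ℕ n → ℕ → Set where
  zero↦ : ∀ {n} {xs : Vec ℕ n} → zeroʳ ⟪ xs ⟫↦ 0
  suc↦  : ∀ {x} → sucʳ ⟪ x ∷ [] ⟫↦ suc x
  proj↦ : ∀ {n} {xs : Vec ℕ n} i → projʳ i ⟪ xs ⟫↦ lookup xs i
  comp↦ : ∀ {m n} {f : Rec m} {gs : Vec (Rec n) m} {xs} ys {z} →
          (∀ i → lookup gs i ⟪ xs ⟫↦ lookup ys i) → f ⟪ ys ⟫↦ z → compʳ f gs ⟪ xs ⟫↦ z
  prim-zero↦ : ∀ {n} {f : Rec n} {g xs z} → f ⟪ xs ⟫↦ z → primʳ f g ⟪ 0 ∷ xs ⟫↦ z
  prim-suc↦  : ∀ {n} {f : Rec n} {g xs k y z} →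
               primʳ f g ⟪ k ∷ xs ⟫↦ y → g ⟪ k ∷ y ∷ xs ⟫↦ z → primʳ f g ⟪ suc k ∷ xs ⟫↦ z
  min↦  : ∀ {n} {f : Rec (suc n)} {xs y} →
          (∀ i → i < y → ∃[ k ] f ⟪ i ∷ xs ⟫↦ suc k) → f ⟪ y ∷ xs ⟫↦ 0 → minʳ f ⟪ xs ⟫↦ y

CE : Pred ℕ 0ℓ → Set
CE A = ∃[ f ] (∀ x → A x ⇔ (∃[ y ] f ⟪ x ∷ [] ⟫↦ y))

CETheory : Theory → Set
CETheory T = CE (λ x → ∃[ σ ] T σ × gn σ ≡ x)

------------------------------------------------------------------------
-- Provability predicates

IsProvabilityPredicate : Theory → Theory → Formula 1 → Set
IsProvabilityPredicate S T Pr = ∀ {n} (φ : Formula n) → (T ⊢ φ) ⇔ (S ⊢ Pr ⟨ ⌜_⌝ {n = 0} φ ⟩)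

CB : Theory → Formula 1 → Set
CB S Pr = ∀ {n} (φ : Formula n) → S ⊢ Pr ⟨ ⌜ ∀̇* φ ⌝ ⟩ ⇒ ∀̇* (Pr ⟨ ⌜ φ ⌝˙ ⟩)

RFN : (∀ {n} → Formula n → Set) → Formula 1 → Pred Sentence 0ℓ
RFN Γ Pr σ = ∃[ n ] ∃[ φ ] Γ {n} φ × σ ≡ ∀̇* (Pr ⟨ ⌜ φ ⌝˙ ⟩ ⇒ φ)

------------------------------------------------------------------------
-- The Gödel numbering is injective

private
  pair-< : ∀ a b c d → a + b < c + d → pair a b < pair c d
  pair-< a b c d lt = begin-strict
    (a + b) * (a + b) + a          ≤⟨ +-monoʳ-≤ ((a + b) * (a + b)) (m≤m+n a b) ⟩
    (a + b) * (a + b) + (a + b)    <⟨ lem (a + b) ⟩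
    suc (a + b) * suc (a + b)      ≤⟨ *-mono-≤ lt lt ⟩
    (c + d) * (c + d)              ≤⟨ m≤m+n _ c ⟩
    (c + d) * (c + d) + c          ∎
    where
    open ≤-Reasoning
    eq : ∀ e → suc e * suc e ≡ suc (e * e + e) + e
    eq = solve-∀
    lem : ∀ e → e * e + e < suc e * suc e
    lem e rewrite eq e = m≤m+n _ e

pair-injective : ∀ {a b c d} → pair a b ≡ pair c d → a ≡ c × b ≡ d
pair-injective {a} {b} {c} {d} eq with <-cmp (a + b) (c + d)
... | tri< lt _ _ = contradiction eq (<⇒≢ (pair-< a b c d lt))
... | tri> _ _ gt = contradiction (sym eq) (<⇒≢ (pair-< c d a b gt))
... | tri≈ _ e _  = a≡c , +-cancelˡ-≡ a b d (trans e (cong (_+ d) (sym a≡c)))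
  where
  a≡c : a ≡ c
  a≡c = +-cancelˡ-≡ ((a + b) * (a + b)) a c (trans eq (cong (λ k → k * k + c) (sym e)))

private
  mutual
    head-injective : ∀ {n} (t u : Term n) → leadingSuccs t ≡ leadingSuccs u →
                     headTag t ≡ headTag u → headBody t ≡ headBody u → t ≡ u
    head-injective (𝐬 t) (𝐬 u) e p q = cong 𝐬 (head-injective t u (cong pred e) p q)
    head-injective (𝐬 _) (var _) () _ _
    head-injective (𝐬 _) 𝟎       () _ _
    head-injective (𝐬 _) (_ ⊕ _) () _ _
    head-injective (𝐬 _) (_ ⊗ _) () _ _
    head-injective (var _) (𝐬 _) () _ _
    head-injective 𝟎       (𝐬 _) () _ _
    head-injective (_ ⊕ _) (𝐬 _) () _ _
    head-injective (_ ⊗ _) (𝐬 _) () _ _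
    head-injective 𝟎       𝟎       _ refl _ = refl
    head-injective (var x) (var y) _ refl q = cong var (toℕ-injective q)
    head-injective (t ⊕ u) (t′ ⊕ u′) _ refl q = pair-gnᵗ _⊕_ t u t′ u′ q
    head-injective (t ⊗ u) (t′ ⊗ u′) _ refl q = pair-gnᵗ _⊗_ t u t′ u′ q

    gnᵗ-injective : ∀ {n} (t u : Term n) → gnᵗ t ≡ gnᵗ u → t ≡ u
    gnᵗ-injective t u eq =
      let e , h = pair-injective {leadingSuccs t} {head t} eq
          p , q = pair-injective {headTag t} {headBody t} h
      in head-injective t u e p q

    pair-gnᵗ : ∀ {n} {A : Set} (_∙_ : Term n → Term n → A) t u t′ u′ →
               pair (gnᵗ t) (gnᵗ u) ≡ pair (gnᵗ t′) (gnᵗ u′) → (t ∙ u) ≡ (t′ ∙ u′)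
    pair-gnᵗ _∙_ t u t′ u′ eq =
      let p , q = pair-injective {gnᵗ t} eq
      in cong₂ _∙_ (gnᵗ-injective t t′ p) (gnᵗ-injective u u′ q)

mutual
  gn-injective : ∀ {n} (φ ψ : Formula n) → gn φ ≡ gn ψ → φ ≡ ψ
  gn-injective φ ψ eq =
    let p , q = pair-injective {tag φ} {body φ} eq in body-injective φ ψ p q

  body-injective : ∀ {n} (φ ψ : Formula n) → tag φ ≡ tag ψ → body φ ≡ body ψ → φ ≡ ψ
  body-injective ⊥̇ ⊥̇ refl _ = refl
  body-injective (t ≐ u) (t′ ≐ u′) refl eq = pair-gnᵗ _≐_ t u t′ u′ eq
  body-injective (t ≼ u) (t′ ≼ u′) refl eq = pair-gnᵗ _≼_ t u t′ u′ eq
  body-injective (φ ⇒ ψ) (φ′ ⇒ ψ′) refl eq =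
    let p , q = pair-injective {gn φ} eq in cong₂ _⇒_ (gn-injective φ φ′ p) (gn-injective ψ ψ′ q)
  body-injective (φ ∧ ψ) (φ′ ∧ ψ′) refl eq =
    let p , q = pair-injective {gn φ} eq in cong₂ _∧_ (gn-injective φ φ′ p) (gn-injective ψ ψ′ q)
  body-injective (φ ∨ ψ) (φ′ ∨ ψ′) refl eq =
    let p , q = pair-injective {gn φ} eq in cong₂ _∨_ (gn-injective φ φ′ p) (gn-injective ψ ψ′ q)
  body-injective (∀̇ φ) (∀̇ ψ) refl eq = cong ∀̇ (gn-injective φ ψ eq)
  body-injective (∃̇ φ) (∃̇ ψ) refl eq = cong ∃̇ (gn-injective φ ψ eq)

------------------------------------------------------------------------
-- The value of ⌜φ(ẋ)⌝ at n⃗ is the Gödel number of φ(n⃗)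

⟦_⟧ : ∀ {n} → Term n → (Fin n → ℕ) → ℕ
⟦ var x ⟧ ν = ν x
⟦ 𝟎 ⟧     ν = 0
⟦ 𝐬 t ⟧   ν = suc (⟦ t ⟧ ν)
⟦ t ⊕ u ⟧ ν = ⟦ t ⟧ ν + ⟦ u ⟧ ν
⟦ t ⊗ u ⟧ ν = ⟦ t ⟧ ν * ⟦ u ⟧ ν

private
  ⟦numeral⟧ : ∀ {n} k (ν : Fin n → ℕ) → ⟦ numeral k ⟧ ν ≡ k
  ⟦numeral⟧ zero    ν = refl
  ⟦numeral⟧ (suc k) ν = cong suc (⟦numeral⟧ k ν)

  wk-numeral : ∀ {n} k → wkᵗ {n} (numeral k) ≡ numeral k
  wk-numeral zero    = refl
  wk-numeral (suc k) = cong 𝐬 (wk-numeral k)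

  succs-numeral : ∀ {n} k → leadingSuccs (numeral {n} k) ≡ k
  succs-numeral zero    = refl
  succs-numeral (suc k) = cong suc (succs-numeral k)

  head-numeral : ∀ {n} k → head (numeral {n} k) ≡ 0
  head-numeral zero    = refl
  head-numeral (suc k) = head-numeral {_} k

  close : ∀ b {n} → (Fin n → ℕ) → Sub (b + n) (b + 0)
  close zero    ν x = numeral (ν x)
  close (suc b) ν   = liftˢ (close b ν)

  Closed : ∀ {b n} → (Fin n → ℕ) → Fin b ⊎ Fin n → Term (b + 0) → Set
  Closed ν (inj₁ j) t = ∃[ y ] t ≡ var y × toℕ y ≡ toℕ j
  Closed ν (inj₂ i) t = t ≡ numeral (ν i)

  close-var : ∀ b {n} (ν : Fin n → ℕ) x → Closed ν (splitAt b x) (close b ν x)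
  close-var zero    ν x       = refl
  close-var (suc b) ν zero    = zero , refl , refl
  close-var (suc b) ν (suc x) with splitAt b x | close-var b ν x
  ... | inj₁ j | y , p , q = suc y , cong wkᵗ p , cong suc q
  ... | inj₂ i | p         = trans (cong wkᵗ p) (wk-numeral (ν i))

  module _ {n} (ν : Fin n → ℕ) where

    succs-correct : ∀ b (t : Term (b + n)) → ⟦ dotSuccs b t ⟧ ν ≡ leadingSuccs (subᵗ (close b ν) t)
    succs-correct b (var x) with splitAt b x | close b ν x | close-var b ν x
    ... | inj₁ j | _ | y , refl , _ = refl
    ... | inj₂ i | _ | refl = sym (succs-numeral (ν i))
    succs-correct b 𝟎       = refl
    succs-correct b (𝐬 t)   = cong suc (succs-correct b t)
    succs-correct b (t ⊕ u) = refl
    succs-correct b (t ⊗ u) = refl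

    mutual
      dotᵗ-correct : ∀ b (t : Term (b + n)) → ⟦ dotᵗ b t ⟧ ν ≡ gnᵗ (subᵗ (close b ν) t)
      dotᵗ-correct b t = cong₂ pair (succs-correct b t) (head-correct b t)

      head-correct : ∀ b (t : Term (b + n)) → ⟦ dotHead b t ⟧ ν ≡ head (subᵗ (close b ν) t)
      head-correct b (var x) with splitAt b x | close b ν x | close-var b ν x
      ... | inj₁ j | _ | y , refl , q = cong (pair 1) (trans (⟦numeral⟧ (toℕ j) ν) (sym q))
      ... | inj₂ i | _ | refl = sym (head-numeral (ν i))
      head-correct b 𝟎       = refl
      head-correct b (𝐬 t)   = head-correct b t
      head-correct b (t ⊕ u) = cong (pair 2) (cong₂ pair (dotᵗ-correct b t) (dotᵗ-correct b u))
      head-correct b (t ⊗ u) = cong (pair 3) (cong₂ pair (dotᵗ-correct b t) (dotᵗ-correct b u))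

    tag-sub : ∀ {k m} (σ : Sub k m) φ → ⟦ numeral (tag φ) ⟧ ν ≡ tag (sub σ φ)
    tag-sub σ ⊥̇       = refl
    tag-sub σ (_ ≐ _) = refl
    tag-sub σ (_ ≼ _) = refl
    tag-sub σ (_ ⇒ _) = refl
    tag-sub σ (_ ∧ _) = refl
    tag-sub σ (_ ∨ _) = refl
    tag-sub σ (∀̇ _)   = refl
    tag-sub σ (∃̇ _)   = refl

    mutual
      dotᶠ-correct : ∀ b (φ : Formula (b + n)) → ⟦ dotᶠ b φ ⟧ ν ≡ gn (sub (close b ν) φ)
      dotᶠ-correct b φ = cong₂ pair (tag-sub (close b ν) φ) (body-correct b φ)

      body-correct : ∀ b (φ : Formula (b + n)) → ⟦ dotBody b φ ⟧ ν ≡ body (sub (close b ν) φ)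
      body-correct b ⊥̇       = refl
      body-correct b (t ≐ u) = cong₂ pair (dotᵗ-correct b t) (dotᵗ-correct b u)
      body-correct b (t ≼ u) = cong₂ pair (dotᵗ-correct b t) (dotᵗ-correct b u)
      body-correct b (φ ⇒ ψ) = cong₂ pair (dotᶠ-correct b φ) (dotᶠ-correct b ψ)
      body-correct b (φ ∧ ψ) = cong₂ pair (dotᶠ-correct b φ) (dotᶠ-correct b ψ)
      body-correct b (φ ∨ ψ) = cong₂ pair (dotᶠ-correct b φ) (dotᶠ-correct b ψ)
      body-correct b (∀̇ φ)   = dotᶠ-correct (suc b) φ
      body-correct b (∃̇ φ)   = dotᶠ-correct (suc b) φ

dot-correct : ∀ {n} (φ : Formula n) (ν : Fin n → ℕ) →
              ⟦ ⌜ φ ⌝˙ ⟧ ν ≡ gn (sub {n = 0} (λ x → numeral (ν x)) φ)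
dot-correct φ ν = dotᶠ-correct ν 0 φ

{-# OPTIONS --safe #-}

-- Write Pr(x) as ∃y⃗ δ(x,y⃗) with δ in Δ₀. Diagonalisation yields a Δ₀ formula
-- φ whose universal closure G satisfies PA ⊢ G ↔ ¬Pr(⌜G⌝). If T proved
-- reflection for φ, then with CB it would prove Pr(⌜G⌝) → G, hence
-- ¬Pr(⌜G⌝), hence G; but then S, and so T, proves Pr(⌜G⌝).
--
-- The diagonalisation needs no representability of recursive functions. Take
-- φ(x,y⃗) to be x ≐ n̄ ⇒ ¬δ(D(x),y⃗), where n is the Gödel number of
-- ¬δ(D(x),y⃗). Since gn is built from the polynomial pairing, the number of
-- the closure of φ is a polynomial in n, and D is this polynomial. It depends
-- only on the number of variables y⃗, so there is no circularity.
module Submission where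

open import Data.Fin using (Fin; zero; suc)
open import Data.List using (List; []; _∷_)
open import Data.List.Relation.Unary.Any using (here; there)
open import Data.Nat using (ℕ; zero; suc; _+_; _*_)
open import Data.Nat.Properties using (+-identityʳ; +-suc; +-comm; *-zeroʳ; *-suc)
open import Data.Product using (_×_; _,_; ∃-syntax)
open import Function.Bundles using (Equivalence)
open import Relation.Binary.PropositionalEquality using (_≡_; refl; sym; trans; cong; cong₂; subst; subst₂)

open import Defs

-- Substitution calculus

subᵗ-renᵗ : ∀ {l m n} {σ : Sub m n} {ρ : Ren l m} {τ : Sub l n} →
            (∀ x → σ (ρ x) ≡ τ x) → ∀ t → subᵗ σ (renᵗ ρ t) ≡ subᵗ τ t
subᵗ-renᵗ e (var x) = e x
subᵗ-renᵗ e 𝟎       = refl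
subᵗ-renᵗ e (𝐬 t)   = cong 𝐬 (subᵗ-renᵗ e t)
subᵗ-renᵗ e (t ⊕ u) = cong₂ _⊕_ (subᵗ-renᵗ e t) (subᵗ-renᵗ e u)
subᵗ-renᵗ e (t ⊗ u) = cong₂ _⊗_ (subᵗ-renᵗ e t) (subᵗ-renᵗ e u)

renᵗ-subᵗ : ∀ {l m n} {ρ : Ren m n} {σ : Sub l m} {τ : Sub l n} →
            (∀ x → renᵗ ρ (σ x) ≡ τ x) → ∀ t → renᵗ ρ (subᵗ σ t) ≡ subᵗ τ t
renᵗ-subᵗ e (var x) = e x
renᵗ-subᵗ e 𝟎       = refl
renᵗ-subᵗ e (𝐬 t)   = cong 𝐬 (renᵗ-subᵗ e t)
renᵗ-subᵗ e (t ⊕ u) = cong₂ _⊕_ (renᵗ-subᵗ e t) (renᵗ-subᵗ e u)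
renᵗ-subᵗ e (t ⊗ u) = cong₂ _⊗_ (renᵗ-subᵗ e t) (renᵗ-subᵗ e u)

subᵗ-subᵗ : ∀ {l m n} {τ : Sub m n} {σ : Sub l m} {υ : Sub l n} →
            (∀ x → subᵗ τ (σ x) ≡ υ x) → ∀ t → subᵗ τ (subᵗ σ t) ≡ subᵗ υ t
subᵗ-subᵗ e (var x) = e x
subᵗ-subᵗ e 𝟎       = refl
subᵗ-subᵗ e (𝐬 t)   = cong 𝐬 (subᵗ-subᵗ e t)
subᵗ-subᵗ e (t ⊕ u) = cong₂ _⊕_ (subᵗ-subᵗ e t) (subᵗ-subᵗ e u)
subᵗ-subᵗ e (t ⊗ u) = cong₂ _⊗_ (subᵗ-subᵗ e t) (subᵗ-subᵗ e u)

subᵗ-id : ∀ {n} {σ : Sub n n} → (∀ x → σ x ≡ var x) → ∀ t → subᵗ σ t ≡ t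
subᵗ-id e (var x) = e x
subᵗ-id e 𝟎       = refl
subᵗ-id e (𝐬 t)   = cong 𝐬 (subᵗ-id e t)
subᵗ-id e (t ⊕ u) = cong₂ _⊕_ (subᵗ-id e t) (subᵗ-id e u)
subᵗ-id e (t ⊗ u) = cong₂ _⊗_ (subᵗ-id e t) (subᵗ-id e u)

renᵗ-as-subᵗ : ∀ {m n} {ρ : Ren m n} {σ : Sub m n} →
               (∀ x → var (ρ x) ≡ σ x) → ∀ t → renᵗ ρ t ≡ subᵗ σ t
renᵗ-as-subᵗ e (var x) = e x
renᵗ-as-subᵗ e 𝟎       = refl
renᵗ-as-subᵗ e (𝐬 t)   = cong 𝐬 (renᵗ-as-subᵗ e t)
renᵗ-as-subᵗ e (t ⊕ u) = cong₂ _⊕_ (renᵗ-as-subᵗ e t) (renᵗ-as-subᵗ e u)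
renᵗ-as-subᵗ e (t ⊗ u) = cong₂ _⊗_ (renᵗ-as-subᵗ e t) (renᵗ-as-subᵗ e u)

subᵗ-instantiate-wkᵗ : ∀ {n} (u t : Term n) → subᵗ (instantiate u) (wkᵗ t) ≡ t
subᵗ-instantiate-wkᵗ u t = trans (subᵗ-renᵗ (λ _ → refl) t) (subᵗ-id (λ _ → refl) t)

subᵗ-liftˢ-wkᵗ : ∀ {m n} (σ : Sub m n) t → subᵗ (liftˢ σ) (wkᵗ t) ≡ wkᵗ (subᵗ σ t)
subᵗ-liftˢ-wkᵗ σ t = trans (subᵗ-renᵗ (λ _ → refl) t) (sym (renᵗ-subᵗ (λ _ → refl) t))

liftˢ-var : ∀ {m n} {ρ : Ren m n} {σ : Sub m n} →
            (∀ x → var (ρ x) ≡ σ x) → ∀ x → var (liftʳ ρ x) ≡ liftˢ σ x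
liftˢ-var e zero    = refl
liftˢ-var e (suc x) = cong wkᵗ (e x)

liftˢ-id : ∀ {n} {σ : Sub n n} → (∀ x → σ x ≡ var x) → ∀ x → liftˢ σ x ≡ var x
liftˢ-id e zero    = refl
liftˢ-id e (suc x) = cong wkᵗ (e x)

liftˢ-liftˢ : ∀ {l m n} {τ : Sub m n} {σ : Sub l m} {υ : Sub l n} →
              (∀ x → subᵗ τ (σ x) ≡ υ x) → ∀ x → subᵗ (liftˢ τ) (liftˢ σ x) ≡ liftˢ υ x
liftˢ-liftˢ e zero = refl
liftˢ-liftˢ {τ = τ} {σ} e (suc x) = trans (subᵗ-liftˢ-wkᵗ τ (σ x)) (cong wkᵗ (e x))

ren-as-sub : ∀ {m n} {ρ : Ren m n} {σ : Sub m n} →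
             (∀ x → var (ρ x) ≡ σ x) → ∀ φ → ren ρ φ ≡ sub σ φ
ren-as-sub e ⊥̇       = refl
ren-as-sub e (t ≐ u) = cong₂ _≐_ (renᵗ-as-subᵗ e t) (renᵗ-as-subᵗ e u)
ren-as-sub e (t ≼ u) = cong₂ _≼_ (renᵗ-as-subᵗ e t) (renᵗ-as-subᵗ e u)
ren-as-sub e (φ ⇒ ψ) = cong₂ _⇒_ (ren-as-sub e φ) (ren-as-sub e ψ)
ren-as-sub e (φ ∧ ψ) = cong₂ _∧_ (ren-as-sub e φ) (ren-as-sub e ψ)
ren-as-sub e (φ ∨ ψ) = cong₂ _∨_ (ren-as-sub e φ) (ren-as-sub e ψ)
ren-as-sub e (∀̇ φ)   = cong ∀̇ (ren-as-sub (liftˢ-var e) φ)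
ren-as-sub e (∃̇ φ)   = cong ∃̇ (ren-as-sub (liftˢ-var e) φ)

-- Agreement of the substitutions is asked for only pointwise, because under a binder the lifted
-- substitutions agree at each variable but not by definition.
sub-sub : ∀ {l m n} {τ : Sub m n} {σ : Sub l m} {υ : Sub l n} →
          (∀ x → subᵗ τ (σ x) ≡ υ x) → ∀ φ → sub τ (sub σ φ) ≡ sub υ φ
sub-sub e ⊥̇       = refl
sub-sub e (t ≐ u) = cong₂ _≐_ (subᵗ-subᵗ e t) (subᵗ-subᵗ e u)
sub-sub e (t ≼ u) = cong₂ _≼_ (subᵗ-subᵗ e t) (subᵗ-subᵗ e u)
sub-sub e (φ ⇒ ψ) = cong₂ _⇒_ (sub-sub e φ) (sub-sub e ψ)
sub-sub e (φ ∧ ψ) = cong₂ _∧_ (sub-sub e φ) (sub-sub e ψ)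
sub-sub e (φ ∨ ψ) = cong₂ _∨_ (sub-sub e φ) (sub-sub e ψ)
sub-sub e (∀̇ φ)   = cong ∀̇ (sub-sub (liftˢ-liftˢ e) φ)
sub-sub e (∃̇ φ)   = cong ∃̇ (sub-sub (liftˢ-liftˢ e) φ)

sub-id : ∀ {n} {σ : Sub n n} → (∀ x → σ x ≡ var x) → ∀ φ → sub σ φ ≡ φ
sub-id e ⊥̇       = refl
sub-id e (t ≐ u) = cong₂ _≐_ (subᵗ-id e t) (subᵗ-id e u)
sub-id e (t ≼ u) = cong₂ _≼_ (subᵗ-id e t) (subᵗ-id e u)
sub-id e (φ ⇒ ψ) = cong₂ _⇒_ (sub-id e φ) (sub-id e ψ)
sub-id e (φ ∧ ψ) = cong₂ _∧_ (sub-id e φ) (sub-id e ψ)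
sub-id e (φ ∨ ψ) = cong₂ _∨_ (sub-id e φ) (sub-id e ψ)
sub-id e (∀̇ φ)   = cong ∀̇ (sub-id (liftˢ-id e) φ)
sub-id e (∃̇ φ)   = cong ∃̇ (sub-id (liftˢ-id e) φ)

-- Viewing the renaming as a substitution reduces the mixed law to `sub-sub`, with no further
-- induction on formulas.
sub-ren : ∀ {l m n} {σ : Sub m n} {ρ : Ren l m} {τ : Sub l n} →
          (∀ x → σ (ρ x) ≡ τ x) → ∀ φ → sub σ (ren ρ φ) ≡ sub τ φ
sub-ren {σ = σ} e φ = trans (cong (sub σ) (ren-as-sub (λ _ → refl) φ)) (sub-sub e φ)

ren-sub : ∀ {l m n} {ρ : Ren m n} {σ : Sub l m} {τ : Sub l n} →
          (∀ x → renᵗ ρ (σ x) ≡ τ x) → ∀ φ → ren ρ (sub σ φ) ≡ sub τ φ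
ren-sub {σ = σ} e φ =
  trans (ren-as-sub (λ _ → refl) (sub σ φ))
        (sub-sub (λ x → trans (sym (renᵗ-as-subᵗ (λ _ → refl) (σ x))) (e x)) φ)

-- A weakened quantified formula ∀x φ or ∃x φ, instantiated at the new variable.
lifted-wk-instantiate : ∀ {n} (φ : Formula (suc n)) → ren (liftʳ suc) φ [ var zero ] ≡ φ
lifted-wk-instantiate φ = trans (sub-ren (λ _ → refl) φ) (sub-id e φ)
  where
  e : ∀ x → instantiate (var zero) (liftʳ suc x) ≡ var x
  e zero    = refl
  e (suc x) = refl

⟨⟩-id : ∀ (P : Formula 1) → P ⟨ var zero ⟩ ≡ P
⟨⟩-id = sub-id λ where zero → refl

renᵗ-numeral : ∀ {m n} (ρ : Ren m n) k → renᵗ ρ (numeral k) ≡ numeral k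
renᵗ-numeral ρ zero    = refl
renᵗ-numeral ρ (suc k) = cong 𝐬 (renᵗ-numeral ρ k)

subᵗ-numeral : ∀ {m n} (σ : Sub m n) k → subᵗ σ (numeral k) ≡ numeral k
subᵗ-numeral σ zero    = refl
subᵗ-numeral σ (suc k) = cong 𝐬 (subᵗ-numeral σ k)

Δ₀-sub : ∀ {m n} (σ : Sub m n) {φ} → Δ₀ φ → Δ₀ (sub σ φ)
Δ₀-sub σ ⊥̇       = ⊥̇
Δ₀-sub σ (t ≐ u) = subᵗ σ t ≐ subᵗ σ u
Δ₀-sub σ (t ≼ u) = subᵗ σ t ≼ subᵗ σ u
Δ₀-sub σ (p ⇒ q) = Δ₀-sub σ p ⇒ Δ₀-sub σ q
Δ₀-sub σ (p ∧ q) = Δ₀-sub σ p ∧ Δ₀-sub σ q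
Δ₀-sub σ (p ∨ q) = Δ₀-sub σ p ∨ Δ₀-sub σ q
-- `∀≼` demands a bound that is literally a weakened term; the rewrite brings the substituted bound
-- back to that form.
Δ₀-sub σ (∀≼ t p) rewrite subᵗ-liftˢ-wkᵗ σ t = ∀≼ (subᵗ σ t) (Δ₀-sub (liftˢ σ) p)
Δ₀-sub σ (∃≼ t p) rewrite subᵗ-liftˢ-wkᵗ σ t = ∃≼ (subᵗ σ t) (Δ₀-sub (liftˢ σ) p)

-- Quantifier blocks

infixr 6 _ʳ+_

-- With this recursion, peeling off the outermost of k quantifiers needs no
-- cast between the arities k + suc n and suc k + n.
_ʳ+_ : ℕ → ℕ → ℕ
zero  ʳ+ n = n
suc k ʳ+ n = k ʳ+ suc n

∀̇^ ∃̇^ : ∀ k {n} → Formula (k ʳ+ n) → Formula n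
∀̇^ zero    φ = φ
∀̇^ (suc k) φ = ∀̇ (∀̇^ k φ)
∃̇^ zero    φ = φ
∃̇^ (suc k) φ = ∃̇ (∃̇^ k φ)

wk^ : ∀ k {n} → Formula n → Formula (k ʳ+ n)
wk^ zero    φ = φ
wk^ (suc k) φ = wk^ k (wk φ)

shift : ∀ k {n} → Fin n → Fin (k ʳ+ n)
shift zero    i = i
shift (suc k) i = shift k (suc i)

liftˢ^ : ∀ k {m n} → Sub m n → Sub (k ʳ+ m) (k ʳ+ n)
liftˢ^ zero    σ = σ
liftˢ^ (suc k) σ = liftˢ^ k (liftˢ σ)

-- `∀̇*` binds the innermost variable first, so each outer quantifier of the block is absorbed by
-- the closure by definition.
∀̇*-∀̇^ : ∀ k {n} (φ : Formula (k ʳ+ n)) → ∀̇* φ ≡ ∀̇* (∀̇^ k φ)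
∀̇*-∀̇^ zero    φ = refl
∀̇*-∀̇^ (suc k) φ = ∀̇*-∀̇^ k φ

sub-∃̇^ : ∀ k {m n} (σ : Sub m n) φ → sub σ (∃̇^ k φ) ≡ ∃̇^ k (sub (liftˢ^ k σ) φ)
sub-∃̇^ zero    σ φ = refl
sub-∃̇^ (suc k) σ φ = cong ∃̇ (sub-∃̇^ k (liftˢ σ) φ)

-- For a variable `k` the weakening `wk^ k` does not reduce. The explicit form on the right is the
-- one whose Gödel number can be computed.
wk^-var≐numeral : ∀ k {n} (i : Fin n) m →
                  wk^ k (var i ≐ numeral m) ≡ (var (shift k i) ≐ numeral m)
wk^-var≐numeral zero    i m = refl
wk^-var≐numeral (suc k) i m =
  trans (cong (λ t → wk^ k (var (suc i) ≐ t)) (renᵗ-numeral suc m)) (wk^-var≐numeral k (suc i) m)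

Σ₁-prenex : ∀ {n} {φ : Formula n} → Σ₁ φ → ∃[ k ] ∃[ χ ] Δ₀ χ × φ ≡ ∃̇^ k χ
Σ₁-prenex (δ p) = 0 , _ , p , refl
Σ₁-prenex (∃̇ p) with Σ₁-prenex p
... | k , χ , q , e = suc k , χ , q , cong ∃̇ e

-- Derivations in an arbitrary theory

module _ {T : Theory} where

  cast : ∀ {n} {Γ : List (Formula n)} {φ ψ} → φ ≡ ψ → T ∣ Γ ⊢ φ → T ∣ Γ ⊢ ψ
  cast refl d = d

  -- With `∀̇^-intro` this is a prenex law: the block variables do not occur in `a`, so a negated
  -- existential block becomes a universal block in front, and the matrix stays Δ₀ if `a` and `χ`
  -- are. Neither direction uses `raa`.
  ∀̇^-elim : ∀ k {n} {Γ : List (Formula n)} a (χ : Formula (k ʳ+ n)) →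
            T ∣ Γ ⊢ ∀̇^ k (wk^ k a ⇒ ∼ χ) ⇒ a ⇒ ∼ ∃̇^ k χ
  ∀̇^-elim zero    a χ = ⇒I (hyp (here refl))
  ∀̇^-elim (suc k) a χ =
    ⇒I (⇒I (⇒I (∃E (hyp (here refl))
      (⇒E (⇒E (⇒E (∀̇^-elim k (wk a) χ)
                  (cast (lifted-wk-instantiate (∀̇^ k _))
                    (∀E (var zero) (hyp (there (there (there (here refl))))))))
              (hyp (there (there (here refl)))))
          (hyp (here refl))))))

  ∀̇^-intro : ∀ k {n} {Γ : List (Formula n)} a (χ : Formula (k ʳ+ n)) →
             T ∣ Γ ⊢ (a ⇒ ∼ ∃̇^ k χ) ⇒ ∀̇^ k (wk^ k a ⇒ ∼ χ)
  ∀̇^-intro zero    a χ = ⇒I (hyp (here refl))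
  ∀̇^-intro (suc k) a χ =
    ⇒I (∀I (⇒E (∀̇^-intro k (wk a) χ)
      (⇒I (⇒I (⇒E (⇒E (hyp (there (there (here refl)))) (hyp (there (here refl))))
        (∃I (var zero)
          (cast (sym (lifted-wk-instantiate (∃̇^ k χ))) (hyp (here refl)))))))))

  -- The tautology is derived from hypotheses alone and then applied to `d` and `e`, so neither has
  -- to be weakened to a longer context.
  ⇒-trans : ∀ {n} {Γ : List (Formula n)} {φ ψ χ} → T ∣ Γ ⊢ φ ⇒ ψ → T ∣ Γ ⊢ ψ ⇒ χ → T ∣ Γ ⊢ φ ⇒ χ
  ⇒-trans d e = ⇒E (⇒E
    (⇒I (⇒I (⇒I (⇒E (hyp (there (here refl)))
      (⇒E (hyp (there (there (here refl)))) (hyp (here refl))))))) d) e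

  ⇒-contract : ∀ {n} {Γ : List (Formula n)} {φ ψ} → T ∣ Γ ⊢ φ ⇒ φ ⇒ ψ → T ∣ Γ ⊢ φ ⇒ ψ
  ⇒-contract d = ⇒E
    (⇒I (⇒I (⇒E (⇒E (hyp (there (here refl))) (hyp (here refl))) (hyp (here refl))))) d

  ∀̇*-intro : ∀ {n} {φ : Formula n} → T ⊢ φ → T ⊢ ∀̇* φ
  ∀̇*-intro {zero}  d = d
  ∀̇*-intro {suc n} d = ∀̇*-intro (∀I d)

  ∀̇-distrib : ∀ {n} {Γ : List (Formula n)} {φ ψ} → T ∣ Γ ⊢ ∀̇ (φ ⇒ ψ) ⇒ ∀̇ φ ⇒ ∀̇ ψ
  ∀̇-distrib {φ = φ} {ψ} = ⇒I (⇒I (∀I (⇒E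
    (cast (lifted-wk-instantiate (φ ⇒ ψ)) (∀E (var zero) (hyp (there (here refl)))))
    (cast (lifted-wk-instantiate φ) (∀E (var zero) (hyp (here refl)))))))

  ∀̇*-distrib : ∀ {n} {φ ψ : Formula n} → T ⊢ ∀̇* (φ ⇒ ψ) → T ⊢ ∀̇* φ ⇒ ∀̇* ψ
  ∀̇*-distrib {zero}  d = d
  -- The induction hypothesis is used twice: first to distribute the closure over `∀̇-distrib`, then
  -- over the resulting implication from `∀̇ φ` to `∀̇ ψ`.
  ∀̇*-distrib {suc n} {φ} {ψ} d = ∀̇*-distrib {φ = ∀̇ φ}
    (⇒E (∀̇*-distrib {φ = ∀̇ (φ ⇒ ψ)} (∀̇*-intro {φ = _ ⇒ ∀̇ φ ⇒ ∀̇ ψ} ∀̇-distrib)) d)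

  module _ {n} {Γ : List (Formula n)} where

    ⟨⟩-transport : ∀ (P : Formula 1) {t u} → T ∣ Γ ⊢ t ≐ u → T ∣ Γ ⊢ P ⟨ t ⟩ → T ∣ Γ ⊢ P ⟨ u ⟩
    ⟨⟩-transport P d e =
      cast (sub-sub (λ _ → refl) P)
        (≐subst (P ⟨ var zero ⟩) d (cast (sym (sub-sub (λ _ → refl) P)) e))

    ≐-cong : ∀ (C : Term (suc n)) {t u} → T ∣ Γ ⊢ t ≐ u →
             T ∣ Γ ⊢ subᵗ (instantiate t) C ≐ subᵗ (instantiate u) C
    ≐-cong C {t} {u} d =
      subst (λ s → T ∣ Γ ⊢ s ≐ subᵗ (instantiate u) C) (subᵗ-instantiate-wkᵗ u _)
        (≐subst (wkᵗ (subᵗ (instantiate t) C) ≐ C) d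
          (subst (λ s → T ∣ Γ ⊢ s ≐ subᵗ (instantiate t) C) (sym (subᵗ-instantiate-wkᵗ t _))
            (≐refl _)))

    ≐-trans : ∀ {t u v} → T ∣ Γ ⊢ t ≐ u → T ∣ Γ ⊢ u ≐ v → T ∣ Γ ⊢ t ≐ v
    ≐-trans {t} {u} {v} d e =
      subst (λ s → T ∣ Γ ⊢ s ≐ v) (subᵗ-instantiate-wkᵗ v t)
        (≐subst (wkᵗ t ≐ var zero) e
          (subst (λ s → T ∣ Γ ⊢ s ≐ u) (sym (subᵗ-instantiate-wkᵗ u t)) d))

    ≐-sym : ∀ {t u} → T ∣ Γ ⊢ t ≐ u → T ∣ Γ ⊢ u ≐ t
    ≐-sym {t} {u} d =
      subst (λ s → T ∣ Γ ⊢ u ≐ s) (subᵗ-instantiate-wkᵗ u t)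
        (≐subst (var zero ≐ wkᵗ t) d
          (subst (λ s → T ∣ Γ ⊢ t ≐ s) (sym (subᵗ-instantiate-wkᵗ t t)) (≐refl t)))

    𝐬-cong : ∀ {t u} → T ∣ Γ ⊢ t ≐ u → T ∣ Γ ⊢ 𝐬 t ≐ 𝐬 u
    𝐬-cong = ≐-cong (𝐬 (var zero))

    ⊕-cong : ∀ {t t′ u u′} → T ∣ Γ ⊢ t ≐ t′ → T ∣ Γ ⊢ u ≐ u′ → T ∣ Γ ⊢ t ⊕ u ≐ t′ ⊕ u′
    ⊕-cong {t} {t′} {u} {u′} d e = ≐-trans
      (subst₂ (λ v w → T ∣ Γ ⊢ t ⊕ v ≐ t′ ⊕ w) (subᵗ-instantiate-wkᵗ t u) (subᵗ-instantiate-wkᵗ t′ u)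
        (≐-cong (var zero ⊕ wkᵗ u) d))
      (subst₂ (λ v w → T ∣ Γ ⊢ v ⊕ u ≐ w ⊕ u′) (subᵗ-instantiate-wkᵗ u t′) (subᵗ-instantiate-wkᵗ u′ t′)
        (≐-cong (wkᵗ t′ ⊕ var zero) e))

    ⊗-cong : ∀ {t t′ u u′} → T ∣ Γ ⊢ t ≐ t′ → T ∣ Γ ⊢ u ≐ u′ → T ∣ Γ ⊢ t ⊗ u ≐ t′ ⊗ u′
    ⊗-cong {t} {t′} {u} {u′} d e = ≐-trans
      (subst₂ (λ v w → T ∣ Γ ⊢ t ⊗ v ≐ t′ ⊗ w) (subᵗ-instantiate-wkᵗ t u) (subᵗ-instantiate-wkᵗ t′ u)
        (≐-cong (var zero ⊗ wkᵗ u) d))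
      (subst₂ (λ v w → T ∣ Γ ⊢ v ⊗ u ≐ w ⊗ u′) (subᵗ-instantiate-wkᵗ u t′) (subᵗ-instantiate-wkᵗ u′ t′)
        (≐-cong (wkᵗ t′ ⊗ var zero) e))

-- Evaluation of terms in PA

module _ {n} {Γ : List (Formula n)} where

  PA-+-s : ∀ t u → PA ∣ Γ ⊢ t ⊕ 𝐬 u ≐ 𝐬 (t ⊕ u)
  PA-+-s t u = subst (λ s → PA ∣ Γ ⊢ s ⊕ 𝐬 u ≐ 𝐬 (s ⊕ u)) (subᵗ-instantiate-wkᵗ u t)
    (∀E u (∀E t (ax +-s)))

  PA-×-s : ∀ t u → PA ∣ Γ ⊢ t ⊗ 𝐬 u ≐ t ⊗ u ⊕ t
  PA-×-s t u = subst (λ s → PA ∣ Γ ⊢ s ⊗ 𝐬 u ≐ s ⊗ u ⊕ s) (subᵗ-instantiate-wkᵗ u t)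
    (∀E u (∀E t (ax ×-s)))

  numeral-+ : ∀ a b → PA ∣ Γ ⊢ numeral a ⊕ numeral b ≐ numeral (a + b)
  numeral-+ a zero    rewrite +-identityʳ a = ∀E (numeral a) (ax +-0)
  numeral-+ a (suc b) rewrite +-suc a b =
    ≐-trans (PA-+-s (numeral a) (numeral b)) (𝐬-cong (numeral-+ a b))

  numeral-* : ∀ a b → PA ∣ Γ ⊢ numeral a ⊗ numeral b ≐ numeral (a * b)
  numeral-* a zero    rewrite *-zeroʳ a = ∀E (numeral a) (ax ×-0)
  -- `*-suc` gives `a + a * b`; commuting the sum matches the order of summands in the axiom `×-s`.
  numeral-* a (suc b) rewrite *-suc a b | +-comm a (a * b) =
    ≐-trans (PA-×-s (numeral a) (numeral b))
      (≐-trans (⊕-cong (numeral-* a b) (≐refl _)) (numeral-+ (a * b) a))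

  -- Induction on the term, each operation being evaluated on numerals. As the diagonal function is
  -- itself a term, this is all the computation asked of PA.
  PA-eval : ∀ {m} {σ : Sub m n} {ν} → (∀ x → σ x ≡ numeral (ν x)) →
            ∀ t → PA ∣ Γ ⊢ subᵗ σ t ≐ numeral (⟦ t ⟧ ν)
  PA-eval e (var x) = subst (λ t → PA ∣ Γ ⊢ t ≐ numeral _) (sym (e x)) (≐refl _)
  PA-eval e 𝟎       = ≐refl _
  PA-eval e (𝐬 t)   = 𝐬-cong (PA-eval e t)
  PA-eval e (t ⊕ u) = ≐-trans (⊕-cong (PA-eval e t) (PA-eval e u)) (numeral-+ (⟦ t ⟧ _) (⟦ u ⟧ _))
  PA-eval e (t ⊗ u) = ≐-trans (⊗-cong (PA-eval e t) (PA-eval e u)) (numeral-* (⟦ t ⟧ _) (⟦ u ⟧ _))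

-- A guarded quantifier in place of substituting a numeral

module _ (P : Formula 1) (D : Term 1) (n : ℕ) where

  private
    value : Term 0
    value = numeral (⟦ D ⟧ (λ _ → n))

    P⟨D⟩⟨n⟩ : ∀ {m} → P ⟨ D ⟩ ⟨ numeral {m} n ⟩ ≡ P ⟨ subᵗ (λ _ → numeral n) D ⟩
    P⟨D⟩⟨n⟩ = sub-sub (λ _ → refl) P

    instance-at-n : ((var zero ≐ numeral n ⇒ ∼ P ⟨ D ⟩) [ numeral n ]) ≡
                    (numeral n ≐ numeral n ⇒ ∼ P ⟨ subᵗ (instantiate (numeral n)) D ⟩)
    instance-at-n = cong₂ (λ t φ → numeral n ≐ t ⇒ ∼ φ) (subᵗ-numeral _ n) (sub-sub (λ _ → refl) P)

    wk-P⟨value⟩ : wk (P ⟨ value ⟩) ≡ P ⟨ numeral (⟦ D ⟧ (λ _ → n)) ⟩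
    wk-P⟨value⟩ = ren-sub (λ _ → renᵗ-numeral suc _) P

  -- Instantiating at `numeral n` turns the guard into a reflexive equation, and there PA evaluates
  -- `D`.
  PA-value-elim : ∀ {Γ} → PA ∣ Γ ⊢ ∀̇ (var zero ≐ numeral n ⇒ ∼ P ⟨ D ⟩) ⇒ ∼ P ⟨ value ⟩
  PA-value-elim = ⇒I (⇒I (⇒E
    (⇒E (cast instance-at-n
          (∀E {φ = var zero ≐ numeral n ⇒ ∼ P ⟨ D ⟩} (numeral n) (hyp (there (here refl)))))
        (≐refl _))
    (⟨⟩-transport P (≐-sym (PA-eval (λ where zero → refl) D)) (hyp (here refl)))))

  -- The guard, now a hypothesis, moves the argument of `D` from the variable to `numeral n`, where
  -- `PA-eval` applies.
  PA-value-intro : ∀ {Γ} → PA ∣ Γ ⊢ ∼ P ⟨ value ⟩ ⇒ ∀̇ (var zero ≐ numeral n ⇒ ∼ P ⟨ D ⟩)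
  PA-value-intro = ⇒I (∀I (⇒I (⇒I (⇒E (hyp (there (there (here refl))))
    (cast (sym wk-P⟨value⟩)
      (⟨⟩-transport P (PA-eval (λ _ → refl) D)
        (cast P⟨D⟩⟨n⟩
          (⟨⟩-transport (P ⟨ D ⟩) (hyp (there (here refl)))
            (cast (sym (⟨⟩-id (P ⟨ D ⟩))) (hyp (here refl)))))))))))

-- Diagonalisation

⟦numeral⟧ : ∀ {n} k (ν : Fin n → ℕ) → ⟦ numeral k ⟧ ν ≡ k
⟦numeral⟧ zero    ν = refl
⟦numeral⟧ (suc k) ν = cong suc (⟦numeral⟧ k ν)

gnᵗ-numeral : ∀ {n} k → gnᵗ (numeral {n} k) ≡ pair k 0
gnᵗ-numeral {n} k = cong₂ pair (succs k) (heads k)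
  where
  succs : ∀ k → leadingSuccs (numeral {n} k) ≡ k
  succs zero    = refl
  succs (suc k) = cong suc (succs k)

  heads : ∀ k → head (numeral {n} k) ≡ 0
  heads zero    = refl
  heads (suc k) = heads k

-- The numerals 6, 3 and 1 here and in diag are the tags of ∀̇, ⇒ and ≐.
∀̇^ᵗ : ∀ {n} → ℕ → Term n → Term n
∀̇^ᵗ zero    t = t
∀̇^ᵗ (suc k) t = pairᵗ (numeral 6) (∀̇^ᵗ k t)

⟦∀̇^ᵗ⟧ : ∀ k {m n} (φ : Formula (k ʳ+ n)) (t : Term m) ν →
        ⟦ t ⟧ ν ≡ gn φ → ⟦ ∀̇^ᵗ k t ⟧ ν ≡ gn (∀̇^ k φ)
⟦∀̇^ᵗ⟧ zero    φ t ν e = e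
⟦∀̇^ᵗ⟧ (suc k) φ t ν e = cong (pair 6) (⟦∀̇^ᵗ⟧ k φ t ν e)

-- `shift k zero` is the diagonal variable x as seen from under the block of `k` quantifiers.
guarded : ∀ k → ℕ → Formula (k ʳ+ 1) → Formula (k ʳ+ 1)
guarded k n ψ = var (shift k zero) ≐ numeral n ⇒ ψ

-- The input is used twice: `pairᵗ (var zero) 𝟎` is the code of its numeral, on the right of the
-- guard, and the last `var zero` is the code of the guarded formula. The `suc k` counts the block
-- together with the quantifier over x.
diag : ℕ → Term 1
diag k = ∀̇^ᵗ (suc k)
  (pairᵗ (numeral 3) (pairᵗ (pairᵗ (numeral 1)
    (pairᵗ (numeral (gnᵗ {k ʳ+ 1} (var (shift k zero)))) (pairᵗ (var zero) 𝟎))) (var zero)))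

⟦diag⟧ : ∀ k (ψ : Formula (k ʳ+ 1)) →
         ⟦ diag k ⟧ (λ _ → gn ψ) ≡ gn (∀̇^ (suc k) {0} (guarded k (gn ψ) ψ))
⟦diag⟧ k ψ = ⟦∀̇^ᵗ⟧ (suc k) (guarded k (gn ψ) ψ) _ _
  (cong (λ c → pair 3 (pair c (gn ψ)))
    (cong (pair 1) (cong₂ pair (⟦numeral⟧ (gnᵗ (var (shift k zero))) _) (sym (gnᵗ-numeral (gn ψ))))))

-- The existential block stripped from `P` returns as the inner universal block of the closure,
-- which is why `φ` itself can be Δ₀.
Δ₀-diagonal : ∀ {P : Formula 1} → Σ₁ P → ∃[ n ] ∃[ φ ] Δ₀ {n} φ ×
              (PA ⊢ ∀̇* φ ⇒ ∼ P ⟨ ⌜ ∀̇* φ ⌝ ⟩) × (PA ⊢ ∼ P ⟨ ⌜ ∀̇* φ ⌝ ⟩ ⇒ ∀̇* φ)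
Δ₀-diagonal {P} p with Σ₁-prenex p
... | k , χ , χ-Δ₀ , P≡ = k ʳ+ 1 , φ , φ-Δ₀ , elim , intro
  where
  D : Term 1
  D = diag k

  χ′ : Formula (k ʳ+ 1)
  χ′ = sub (liftˢ^ k (λ _ → D)) χ

  n : ℕ
  n = gn (∼ χ′)

  φ : Formula (k ʳ+ 1)
  φ = guarded k n (∼ χ′)

  φ-Δ₀ : Δ₀ φ
  φ-Δ₀ = (_ ≐ _) ⇒ (Δ₀-sub _ χ-Δ₀ ⇒ ⊥̇)

  closure : ∀̇* φ ≡ ∀̇ (∀̇^ k φ)
  closure = ∀̇*-∀̇^ k φ

  value : ⟦ D ⟧ (λ _ → n) ≡ gn (∀̇* φ)
  value = trans (⟦diag⟧ k (∼ χ′)) (cong gn (sym closure))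

  P⟨D⟩ : P ⟨ D ⟩ ≡ ∃̇^ k χ′
  P⟨D⟩ = trans (cong (_⟨ D ⟩) P≡) (sub-∃̇^ k _ χ)

  guard : wk^ k (var zero ≐ numeral n) ≡ (var (shift k zero) ≐ numeral n)
  guard = wk^-var≐numeral k zero n

  block-elim : PA ⊢ ∀̇^ k φ ⇒ var zero ≐ numeral n ⇒ ∼ P ⟨ D ⟩
  block-elim = subst₂ (λ a ψ → PA ⊢ ∀̇^ k (a ⇒ ∼ χ′) ⇒ var zero ≐ numeral n ⇒ ∼ ψ)
    guard (sym P⟨D⟩) (∀̇^-elim k (var zero ≐ numeral n) χ′)

  block-intro : PA ⊢ (var zero ≐ numeral n ⇒ ∼ P ⟨ D ⟩) ⇒ ∀̇^ k φ
  block-intro = subst₂ (λ a ψ → PA ⊢ (var zero ≐ numeral n ⇒ ∼ ψ) ⇒ ∀̇^ k (a ⇒ ∼ χ′))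
    guard (sym P⟨D⟩) (∀̇^-intro k (var zero ≐ numeral n) χ′)

  elim : PA ⊢ ∀̇* φ ⇒ ∼ P ⟨ ⌜ ∀̇* φ ⌝ ⟩
  -- Self-reference enters here: by `value`, the number computed for `D` at `n` is the code of the
  -- closure itself.
  elim = subst₂ (λ g m → PA ⊢ g ⇒ ∼ P ⟨ numeral m ⟩) (sym closure) value
    (⇒-trans (∀̇*-distrib {φ = ∀̇^ k φ} (∀I block-elim)) (PA-value-elim P D n))

  intro : PA ⊢ ∼ P ⟨ ⌜ ∀̇* φ ⌝ ⟩ ⇒ ∀̇* φ
  intro = subst₂ (λ g m → PA ⊢ ∼ P ⟨ numeral m ⟩ ⇒ g) (sym closure) value
    (⇒-trans (PA-value-intro P D n) (∀̇*-distrib {ψ = ∀̇^ k φ} (∀I block-intro)))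

-- Reflection for the fixed point contradicts consistency

module _ {S T : Theory} {Pr : Formula 1} (T-consistent : Consistent T)
         (PA⊆T : PA IsExtendedBy T) (S⊆T : S IsExtendedBy T)
         (Pr-provability : IsProvabilityPredicate S T Pr) (cb : CB S Pr) where

  reflection-unprovable : ∀ {n} (φ : Formula n) →
    PA ⊢ ∀̇* φ ⇒ ∼ Pr ⟨ ⌜ ∀̇* φ ⌝ ⟩ → PA ⊢ ∼ Pr ⟨ ⌜ ∀̇* φ ⌝ ⟩ ⇒ ∀̇* φ →
    T ⊬ ∀̇* (Pr ⟨ ⌜ φ ⌝˙ ⟩ ⇒ φ)
  reflection-unprovable φ elim intro rfn =
    T-consistent (⇒E ⊢∼PrG (S⊆T PrG (Equivalence.to (Pr-provability G) ⊢G)))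
    where
    G PrG : Sentence
    G   = ∀̇* φ
    PrG = Pr ⟨ ⌜ G ⌝ ⟩

    PrG⇒G : T ⊢ PrG ⇒ G
    -- `cb` passes from provability of the closure to the universally quantified provability of its
    -- instances, over which `rfn` is distributed.
    PrG⇒G = ⇒-trans (S⊆T (PrG ⇒ ∀̇* (Pr ⟨ ⌜ φ ⌝˙ ⟩)) (cb φ)) (∀̇*-distrib {φ = Pr ⟨ ⌜ φ ⌝˙ ⟩} {φ} rfn)

    ⊢∼PrG : T ⊢ ∼ PrG
    -- Chaining through `G` gives `PrG ⇒ PrG ⇒ ⊥̇`, since `∼ PrG` unfolds to an implication;
    -- contraction merges the two premises.
    ⊢∼PrG = ⇒-contract (⇒-trans PrG⇒G (PA⊆T (G ⇒ ∼ PrG) elim))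

    ⊢G : T ⊢ G
    ⊢G = ⇒E (PA⊆T (∼ PrG ⇒ G) intro) ⊢∼PrG

proposition3p9 : (S T : Theory) →
    CETheory S → CETheory T →
    Consistent S → Consistent T →
    PA IsExtendedBy S → PA IsExtendedBy T →
    S IsExtendedBy T →
    (Pr : Formula 1) →
    Σ₁ Pr →
    IsProvabilityPredicate S T Pr →
    CB S Pr →
    T ⊬ˢ RFN Δ₀ Pr
proposition3p9 S T _ _ _ T-consistent _ PA⊆T S⊆T Pr Pr-Σ₁ Pr-provability cb =
  let n , φ , φ-Δ₀ , elim , intro = Δ₀-diagonal Pr-Σ₁
  in ∀̇* (Pr ⟨ ⌜ φ ⌝˙ ⟩ ⇒ φ) , (n , φ , φ-Δ₀ , refl) ,
     reflection-unprovable T-consistent PA⊆T S⊆T Pr-provability cb φ elim intro
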